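{- For every integer $n\geqslant 0$, $$C_{n+1}(x,y,z)=\sum_{k=0}^n\binom{n}{k}C_k(x,y,z)E_{n-k+1}(x,y,z).$$
   Context: A Stirling permutation of a multiset is a word using each element of the multiset with its multiplicity such that for each value $i$, all letters occurring between two occurrences of $i$ are at least $i$. For $n\geqslant1$, $\mathcal{Q}_n$ is the set of Stirling permutations of $\{1,1,2,2,\ldots,n,n\}$ and $\mathcal{Q}_n^{(1)}$ is the set of Stirling permutations of $\{1,2,2,3,3,\ldots,n,n\}$. For a word $\sigma=\sigma_1\cdots\sigma_L$ set $\sigma_0=\sigma_{L+1}=0$; then ${\rm asc}(\sigma)=\#\{i\in\{0,\ldots,L\}:\sigma_i<\sigma_{i+1}\}$, ${\rm des}(\sigma)=\#\{i\in\{0,\ldots,L\}:\sigma_i>\sigma_{i+1}\}$, ${\rm plat}(\sigma)=\#\{i\in\{0,\ldots,L\}:\sigma_i=\sigma_{i+1}\}$. The trivariate second-order Eulerian polynomials are $C_n(x,y,z)=\sum_{\sigma\in\mathcal{Q}_n}x^{{\rm asc}(\sigma)}y^{{\rm des}(\sigma)}z^{{\rm plat}(\sigma)}$ for $n\geqslant1$, with the convention $C_0(x,y,z)=x$. Also $E_n(x,y,z)=\sum_{\sigma\in\mathcal{Q}_n^{(1)}}x^{{\rm plat}(\sigma)}y^{{\rm des}(\sigma)}z^{{\rm asc}(\sigma)}$ for $n\geqslant 1$. -}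

module Defs where

open import Data.Nat using (ℕ; zero; suc; _+_; _*_; _∸_; _<ᵇ_; _≤ᵇ_; _≡ᵇ_)
open import Data.Nat.Combinatorics using (_C_)
open import Data.Bool using (Bool; true; false; _∧_; _∨_; not; if_then_else_)
open import Data.List using (List; []; _∷_; _++_; map; concatMap; length; upTo; sum; foldr)
open import Data.Product using (_×_; _,_)
open import Relation.Binary.PropositionalEquality using (_≡_)

-- Trivariate polynomials with natural-number coefficients, represented
-- by their coefficient function: P a b c = coefficient of x^a y^b z^c.

Poly : Set
Poly = ℕ → ℕ → ℕ → ℕ

Σ≤ : ℕ → (ℕ → ℕ) → ℕ
Σ≤ zero    f = f zero
Σ≤ (suc n) f = Σ≤ n f + f (suc n)

_⊕_ : Poly → Poly → Poly
(P ⊕ Q) a b c = P a b c + Q a b c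

_⊙_ : ℕ → Poly → Poly
(k ⊙ P) a b c = k * P a b c

_⊗_ : Poly → Poly → Poly
(P ⊗ Q) a b c =
  Σ≤ a λ i → Σ≤ b λ j → Σ≤ c λ k → P i j k * Q (a ∸ i) (b ∸ j) (c ∸ k)

𝟘 : Poly
𝟘 _ _ _ = 0

X : Poly
X a b c = if (a ≡ᵇ 1) ∧ (b ≡ᵇ 0) ∧ (c ≡ᵇ 0) then 1 else 0

ΣP : ℕ → (ℕ → Poly) → Poly
ΣP zero    F = F zero
ΣP (suc n) F = ΣP n F ⊕ F (suc n)

_≈P_ : Poly → Poly → Set
P ≈P Q = ∀ a b c → P a b c ≡ Q a b c

Word : Set
Word = List ℕ

words : ℕ → ℕ → List Word
words m zero    = [] ∷ []
words m (suc L) = concatMap (λ w → map (λ i → suc i ∷ w) (upTo m)) (words m L)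

at : Word → ℕ → ℕ
at []      _       = 0
at (x ∷ w) zero    = x
at (x ∷ w) (suc p) = at w p

allB : List ℕ → (ℕ → Bool) → Bool
allB xs f = foldr (λ x r → f x ∧ r) true xs

filterᵇ : {A : Set} → (A → Bool) → List A → List A
filterᵇ f []      = []
filterᵇ f (x ∷ xs) = if f x then x ∷ filterᵇ f xs else filterᵇ f xs

count : ℕ → Word → ℕ
count i []      = 0
count i (x ∷ w) = (if x ≡ᵇ i then 1 else 0) + count i w

isStirling : Word → Bool
isStirling w =
  allB (upTo L) λ p → allB (upTo L) λ q →
    not ((p <ᵇ q) ∧ (at w p ≡ᵇ at w q)) ∨
    allB (upTo L) (λ r → not ((p <ᵇ r) ∧ (r <ᵇ q)) ∨ (at w p ≤ᵇ at w r))
  where L = length w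

-- statistics on σ with σ_0 = σ_{L+1} = 0
padded : Word → Word
padded w = 0 ∷ (w ++ (0 ∷ []))

countPairs : (ℕ → ℕ → Bool) → Word → ℕ
countPairs R []            = 0
countPairs R (x ∷ [])      = 0
countPairs R (x ∷ y ∷ w)   = (if R x y then 1 else 0) + countPairs R (y ∷ w)

asc des plat : Word → ℕ
asc  w = countPairs (λ a b → a <ᵇ b) (padded w)
des  w = countPairs (λ a b → b <ᵇ a) (padded w)
plat w = countPairs (λ a b → a ≡ᵇ b) (padded w)

Qset : ℕ → List Word
Qset n = filterᵇ (λ w → isStirling w ∧ allB (upTo n) (λ i → count (suc i) w ≡ᵇ 2))
                (words n (2 * n))

-- Stirling permutations of {1,2,2,3,3,…,n,n}  (n ≥ 1)
mult1 : ℕ → ℕ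
mult1 zero    = 1
mult1 (suc _) = 2

Q1set : ℕ → List Word
Q1set n = filterᵇ (λ w → isStirling w ∧ allB (upTo n) (λ i → count (suc i) w ≡ᵇ mult1 i))
                 (words n (2 * n ∸ 1))

genPoly : (Word → ℕ) → (Word → ℕ) → (Word → ℕ) → List Word → Poly
genPoly s₁ s₂ s₃ ws a b c =
  length (filterᵇ (λ w → (s₁ w ≡ᵇ a) ∧ (s₂ w ≡ᵇ b) ∧ (s₃ w ≡ᵇ c)) ws)

Cpoly : ℕ → Poly
Cpoly zero        = X
Cpoly n@(suc _)   = genPoly asc des plat (Qset n)

-- E_n(x,y,z) = Σ_{σ∈Q_n^{(1)}} x^plat y^des z^asc  (only used for n ≥ 1)
Epoly : ℕ → Poly
Epoly n = genPoly plat des asc (Q1set n)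

{-# OPTIONS --safe #-}

-- Let D f (a,b,c) = a f(a,b+1,c+1) + b f(a+1,b,c+1) + c f(a+1,b+1,c), the
-- transpose of the derivation xyz(∂x + ∂y + ∂z) acting on functions of
-- exponent triples. Every Stirling permutation containing n+1 twice arises
-- uniquely by inserting the factor (n+1)(n+1) into a gap of a smaller one, and
-- this replaces the gap, whatever its type, by an ascent, a plateau and a
-- descent; hence C_{k+1} and E_{l+1} are obtained from C_k and E_l by the
-- derivation. As C_0 E_1 = x · yz = C_1, the theorem is the Leibniz rule for
-- its n-th power.

module Submission where

open import Defs
open import Data.Bool using (Bool; true; false; T; not; _∧_; _∨_; if_then_else_)
open import Data.Bool.Properties using (T-∧; T?)
open import Data.Empty using (⊥-elim)
open import Data.List using (List; []; _∷_; _++_; map; filter; concatMap; length; upTo)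
open import Data.List.Membership.Propositional using (_∈_; _∉_; find; lose)
open import Data.List.Membership.Propositional.Properties
  using (∈-++⁺ˡ; ∈-++⁺ʳ; ∈-++⁻; ∈-map⁺; ∈-map⁻; ∈-upTo⁺; ∈-upTo⁻; ∈-filter⁺; ∈-filter⁻;
         ∈-concatMap⁺; ∈-concatMap⁻)
open import Data.List.Membership.Propositional.Properties.WithK using (unique∧set⇒bag)
open import Data.List.Properties
  using (∷-injectiveˡ; ∷-injectiveʳ; map-∘; map-++; filter-all; filter-reject; filter-accept)
open import Data.List.Relation.Binary.BagAndSetEquality using (∼bag⇒↭)
open import Data.List.Relation.Binary.Permutation.Propositional using (_↭_)
open import Data.List.Relation.Binary.Permutation.Propositional.Properties using (map⁺)
open import Data.List.Relation.Unary.All as All using (All; []; _∷_)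
open import Data.List.Relation.Unary.AllPairs using ([]; _∷_)
open import Data.List.Relation.Unary.Any using (here; there)
open import Data.List.Relation.Unary.Unique.Propositional using (Unique)
import Data.List.Relation.Unary.Unique.Propositional.Properties as Unique
open import Data.Nat
open import Data.Nat.Combinatorics using (_C_; k>n⇒nCk≡0; nCk≡nC[n∸k]; nCn≡1; nCk+nC[k+1]≡[n+1]C[k+1])
open import Data.Nat.ListAction using (sum)
open import Data.Nat.ListAction.Properties using (sum-++; sum-↭)
open import Data.Nat.Properties
open import Data.Nat.Tactic.RingSolver using (solve-∀)
open import Data.Product using (_×_; _,_; proj₁; proj₂; ∃; ∃₂)
open import Data.Sum using (inj₁; inj₂)
open import Data.Unit using (⊤; tt)
open import Function using (_∘_; _⇔_; mk⇔; Equivalence)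
open import Relation.Binary.Definitions using (tri<; tri≈; tri>)
open import Relation.Binary.PropositionalEquality
open import Relation.Nullary using (Dec; yes; no; contradiction; ¬?)

open Equivalence using (to; from)
open ≡-Reasoning

private
  variable
    A B : Set

-- Finite sums

∑ : (A → ℕ) → List A → ℕ
∑ f xs = sum (map f xs)

∑-cong-∈ : ∀ {f g : A → ℕ} xs → (∀ {x} → x ∈ xs → f x ≡ g x) → ∑ f xs ≡ ∑ g xs
∑-cong-∈ []       eq = refl
∑-cong-∈ (x ∷ xs) eq = cong₂ _+_ (eq (here refl)) (∑-cong-∈ xs (eq ∘ there))

∑-cong : ∀ {f g : A → ℕ} xs → (∀ x → f x ≡ g x) → ∑ f xs ≡ ∑ g xs
∑-cong xs eq = ∑-cong-∈ xs (λ {x} _ → eq x)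

∑-map : ∀ (f : B → ℕ) (g : A → B) xs → ∑ f (map g xs) ≡ ∑ (f ∘ g) xs
∑-map f g xs = cong sum (sym (map-∘ xs))

∑-++ : ∀ (f : A → ℕ) xs ys → ∑ f (xs ++ ys) ≡ ∑ f xs + ∑ f ys
∑-++ f xs ys = trans (cong sum (map-++ f xs ys)) (sum-++ (map f xs) (map f ys))

∑-concatMap : ∀ (f : B → ℕ) (g : A → List B) xs → ∑ f (concatMap g xs) ≡ ∑ (∑ f ∘ g) xs
∑-concatMap f g []       = refl
∑-concatMap f g (x ∷ xs) =
  trans (∑-++ f (g x) (concatMap g xs)) (cong (∑ f (g x) +_) (∑-concatMap f g xs))

+-interchange : ∀ a b c d → (a + b) + (c + d) ≡ (a + c) + (b + d)
+-interchange = solve-∀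

∑-+ : ∀ (f g : A → ℕ) xs → ∑ (λ x → f x + g x) xs ≡ ∑ f xs + ∑ g xs
∑-+ f g []       = refl
∑-+ f g (x ∷ xs) =
  trans (cong (f x + g x +_) (∑-+ f g xs)) (+-interchange (f x) (g x) (∑ f xs) (∑ g xs))

∑-zero : ∀ (xs : List A) → ∑ (λ _ → 0) xs ≡ 0
∑-zero []       = refl
∑-zero (x ∷ xs) = ∑-zero xs

∑-swap : ∀ (F : A → B → ℕ) xs ys →
         ∑ (λ x → ∑ (F x) ys) xs ≡ ∑ (λ y → ∑ (λ x → F x y) xs) ys
∑-swap F []       ys = sym (∑-zero ys)
∑-swap F (x ∷ xs) ys =
  trans (cong (∑ (F x) ys +_) (∑-swap F xs ys)) (sym (∑-+ (F x) _ ys))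

*-distribˡ-∑ : ∀ c (f : A → ℕ) xs → c * ∑ f xs ≡ ∑ (λ x → c * f x) xs
*-distribˡ-∑ c f []       = *-zeroʳ c
*-distribˡ-∑ c f (x ∷ xs) =
  trans (*-distribˡ-+ c (f x) (∑ f xs)) (cong (c * f x +_) (*-distribˡ-∑ c f xs))

∑-*-∑ : ∀ (f : A → ℕ) (g : B → ℕ) xs ys →
        ∑ f xs * ∑ g ys ≡ ∑ (λ x → ∑ (λ y → f x * g y) ys) xs
∑-*-∑ f g []       ys = refl
∑-*-∑ f g (x ∷ xs) ys =
  trans (*-distribʳ-+ (∑ g ys) (f x) (∑ f xs)) (cong₂ _+_ (*-distribˡ-∑ (f x) g ys) (∑-*-∑ f g xs ys))

∑-filterᵇ : ∀ (p : A → Bool) xs → length (filterᵇ p xs) ≡ ∑ (λ x → if p x then 1 else 0) xs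
∑-filterᵇ p []       = refl
∑-filterᵇ p (x ∷ xs) with p x
... | true  = cong suc (∑-filterᵇ p xs)
... | false = ∑-filterᵇ p xs

Σ≤-cong-≤ : ∀ n {f g : ℕ → ℕ} → (∀ {i} → i ≤ n → f i ≡ g i) → Σ≤ n f ≡ Σ≤ n g
Σ≤-cong-≤ zero    eq = eq z≤n
Σ≤-cong-≤ (suc n) eq = cong₂ _+_ (Σ≤-cong-≤ n (eq ∘ m≤n⇒m≤1+n)) (eq ≤-refl)

Σ≤-cong : ∀ n {f g : ℕ → ℕ} → (∀ i → f i ≡ g i) → Σ≤ n f ≡ Σ≤ n g
Σ≤-cong n eq = Σ≤-cong-≤ n (λ {i} _ → eq i)

Σ≤-zero : ∀ n → Σ≤ n (λ _ → 0) ≡ 0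
Σ≤-zero zero    = refl
Σ≤-zero (suc n) = trans (+-identityʳ _) (Σ≤-zero n)

Σ≤-+ : ∀ n (f g : ℕ → ℕ) → Σ≤ n (λ i → f i + g i) ≡ Σ≤ n f + Σ≤ n g
Σ≤-+ zero    f g = refl
Σ≤-+ (suc n) f g =
  trans (cong (_+ (f (suc n) + g (suc n))) (Σ≤-+ n f g))
        (+-interchange (Σ≤ n f) (Σ≤ n g) (f (suc n)) (g (suc n)))

Σ≤-*ˡ : ∀ n c (f : ℕ → ℕ) → Σ≤ n (λ i → c * f i) ≡ c * Σ≤ n f
Σ≤-*ˡ zero    c f = refl
Σ≤-*ˡ (suc n) c f =
  trans (cong (_+ c * f (suc n)) (Σ≤-*ˡ n c f)) (sym (*-distribˡ-+ c (Σ≤ n f) (f (suc n))))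

Σ≤-*ʳ : ∀ n c (f : ℕ → ℕ) → Σ≤ n (λ i → f i * c) ≡ Σ≤ n f * c
Σ≤-*ʳ n c f =
  trans (Σ≤-cong n (λ i → *-comm (f i) c)) (trans (Σ≤-*ˡ n c f) (*-comm c (Σ≤ n f)))

Σ≤-head : ∀ n (f : ℕ → ℕ) → Σ≤ (suc n) f ≡ f 0 + Σ≤ n (f ∘ suc)
Σ≤-head zero    f = refl
Σ≤-head (suc n) f =
  trans (cong (_+ f (suc (suc n))) (Σ≤-head n f)) (+-assoc (f 0) _ _)

Σ≤-∑-swap : ∀ n (F : ℕ → A → ℕ) xs → Σ≤ n (λ i → ∑ (F i) xs) ≡ ∑ (λ x → Σ≤ n (λ i → F i x)) xs
Σ≤-∑-swap zero    F xs = refl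
Σ≤-∑-swap (suc n) F xs =
  trans (cong (_+ ∑ (F (suc n)) xs) (Σ≤-∑-swap n F xs)) (sym (∑-+ _ (F (suc n)) xs))

Σ≤-∑∑-swap : ∀ n (F : ℕ → A → B → ℕ) xs ys →
             Σ≤ n (λ i → ∑ (λ x → ∑ (F i x) ys) xs) ≡ ∑ (λ x → ∑ (λ y → Σ≤ n (λ i → F i x y)) ys) xs
Σ≤-∑∑-swap n F xs ys =
  trans (Σ≤-∑-swap n (λ i x → ∑ (F i x) ys) xs) (∑-cong xs (λ x → Σ≤-∑-swap n (λ i → F i x) ys))

-- Duplicate-free lists

-- Without repetitions each multiplicity is 0 or 1, so set equality is already bag equality.
unique⇔⇒↭ : ∀ {xs ys : List A} → Unique xs → Unique ys → (∀ {x} → x ∈ xs ⇔ x ∈ ys) → xs ↭ ys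
unique⇔⇒↭ ux uy eq = ∼bag⇒↭ (unique∧set⇒bag ux uy eq)

∑-↭ : ∀ (f : A → ℕ) {xs ys} → xs ↭ ys → ∑ f xs ≡ ∑ f ys
∑-↭ f xs↭ys = sum-↭ (map⁺ f xs↭ys)

∈-concatMap⇒ : ∀ (f : A → List B) xs {y} → y ∈ concatMap f xs → ∃ λ x → x ∈ xs × y ∈ f x
∈-concatMap⇒ f xs = find ∘ ∈-concatMap⁻ f {xs}

∈-concatMap⇐ : ∀ (f : A → List B) {xs x y} → x ∈ xs → y ∈ f x → y ∈ concatMap f xs
∈-concatMap⇐ f x∈xs y∈fx = ∈-concatMap⁺ f (lose x∈xs y∈fx)

-- The map `g` recovers from an element of a block `f x` the index `x`, so blocks of different
-- indices are disjoint.
concatMap-unique : ∀ (f : A → List B) (g : B → A) {xs} →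
                   (∀ {x} → x ∈ xs → Unique (f x)) →
                   (∀ {x} → x ∈ xs → ∀ {y} → y ∈ f x → g y ≡ x) →
                   Unique xs → Unique (concatMap f xs)
concatMap-unique f g {[]}     uf gf []         = []
concatMap-unique f g {x ∷ xs} uf gf (x∉ ∷ uxs) =
  Unique.++⁺ (uf (here refl)) (concatMap-unique f g (uf ∘ there) (gf ∘ there) uxs) disjoint
  where
  disjoint : ∀ {y} → (y ∈ f x × y ∈ concatMap f xs) → _
  disjoint (y∈ , y∈′) with ∈-concatMap⇒ f xs y∈′
  ... | x′ , x′∈ , y∈fx′ =
    All.lookup x∉ x′∈ (trans (sym (gf (here refl) y∈)) (gf (there x′∈) y∈fx′))

filterᵇ≡filter : ∀ (p : A → Bool) xs → filterᵇ p xs ≡ filter (T? ∘ p) xs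
filterᵇ≡filter p []       = refl
filterᵇ≡filter p (x ∷ xs) with p x
... | true  = cong (x ∷_) (filterᵇ≡filter p xs)
... | false = filterᵇ≡filter p xs

-- Words

Letter : ℕ → ℕ → Set
Letter m x = 0 < x × x ≤ m

words-unique : ∀ m L → Unique (words m L)
words-unique m zero    = [] ∷ []
words-unique m (suc L) = concatMap-unique extend tail
  (λ _ → Unique.map⁺ (suc-injective ∘ ∷-injectiveˡ) (Unique.upTo⁺ m))
  (λ _ → tail-extend)
  (words-unique m L)
  where
  extend : Word → List Word
  extend w = map (λ i → suc i ∷ w) (upTo m)

  tail : Word → Word
  tail []      = []
  tail (x ∷ w) = w

  tail-extend : ∀ {w v} → v ∈ extend w → tail v ≡ w
  tail-extend v∈ with ∈-map⁻ _ v∈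
  ... | _ , _ , refl = refl

∈-words⇒ : ∀ m L {w} → w ∈ words m L → length w ≡ L × All (Letter m) w
∈-words⇒ m zero    (here refl) = refl , []
∈-words⇒ m (suc L) w∈ with ∈-concatMap⇒ _ (words m L) w∈
... | v , v∈ , w∈v with ∈-map⁻ _ w∈v | ∈-words⇒ m L v∈
... | i , i∈ , refl | refl , all = refl , (z<s , ∈-upTo⁻ i∈) ∷ all

∈-words⇐ : ∀ m {w} → All (Letter m) w → w ∈ words m (length w)
∈-words⇐ m []                           = here refl
∈-words⇐ m {suc i ∷ w} ((_ , i<m) ∷ all) =
  ∈-concatMap⇐ (λ v → map (λ j → suc j ∷ v) (upTo m)) (∈-words⇐ m all) (∈-map⁺ _ (∈-upTo⁺ i<m))

count-∷-≡ : ∀ m w → count m (m ∷ w) ≡ suc (count m w)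
count-∷-≡ m w with m ≡ᵇ m in eq
... | true  = refl
... | false = ⊥-elim (subst T eq (≡⇒≡ᵇ m m refl))

count-∷-≢ : ∀ {i x} w → x ≢ i → count i (x ∷ w) ≡ count i w
count-∷-≢ {i} {x} w x≢i with x ≡ᵇ i in eq
... | true  = contradiction (≡ᵇ⇒≡ x i (subst T (sym eq) tt)) x≢i
... | false = refl

count-++ : ∀ i v w → count i (v ++ w) ≡ count i v + count i w
count-++ i []      w = refl
count-++ i (x ∷ v) w =
  trans (cong (k +_) (count-++ i v w)) (sym (+-assoc k (count i v) (count i w)))
  where k = if x ≡ᵇ i then 1 else 0

∉⇒count≡0 : ∀ {i} w → i ∉ w → count i w ≡ 0
∉⇒count≡0 []      i∉ = refl
∉⇒count≡0 (x ∷ w) i∉ =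
  trans (count-∷-≢ w (i∉ ∘ here ∘ sym)) (∉⇒count≡0 w (i∉ ∘ there))

count≡0⇒∉ : ∀ {i w} → count i w ≡ 0 → i ∉ w
count≡0⇒∉ {i} {x ∷ w} c≡0 (here refl) = 1+n≢0 (trans (sym (count-∷-≡ i w)) c≡0)
count≡0⇒∉ {i} {x ∷ w} c≡0 (there i∈)  =
  count≡0⇒∉ (m+n≡0⇒n≡0 (if x ≡ᵇ i then 1 else 0) c≡0) i∈

<⇒∉ : ∀ {m w} → All (_< m) w → m ∉ w
<⇒∉ all m∈ = <-irrefl refl (All.lookup all m∈)

≤∧∉⇒< : ∀ {m w} → All (_≤ m) w → m ∉ w → All (_< m) w
≤∧∉⇒< []          m∉ = []
≤∧∉⇒< (x≤m ∷ all) m∉ = ≤∧≢⇒< x≤m (m∉ ∘ here ∘ sym) ∷ ≤∧∉⇒< all (m∉ ∘ there)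

All-middle⁺ : ∀ {P : ℕ → Set} {m} a {c} → P m → All P (a ++ c) → All P (a ++ m ∷ m ∷ c)
All-middle⁺ []      pm all       = pm ∷ pm ∷ all
All-middle⁺ (x ∷ a) pm (p ∷ all) = p ∷ All-middle⁺ a pm all

All-middle⁻ : ∀ {P : ℕ → Set} {m} a {c} → All P (a ++ m ∷ m ∷ c) → All P (a ++ c)
All-middle⁻ []      (_ ∷ _ ∷ all) = all
All-middle⁻ (x ∷ a) (p ∷ all)     = p ∷ All-middle⁻ a all

length-middle : ∀ (m : ℕ) a c → length (a ++ m ∷ m ∷ c) ≡ 2 + length (a ++ c)
length-middle m []      c = refl
length-middle m (x ∷ a) c = cong suc (length-middle m a c)

count-middle-≡ : ∀ m a c → count m (a ++ m ∷ m ∷ c) ≡ 2 + count m (a ++ c)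
count-middle-≡ m []      c = trans (count-∷-≡ m (m ∷ c)) (cong suc (count-∷-≡ m c))
count-middle-≡ m (x ∷ a) c =
  trans (cong (k +_) (count-middle-≡ m a c))
        (trans (+-suc k _) (cong suc (+-suc k _)))
  where k = if x ≡ᵇ m then 1 else 0

count-middle-≢ : ∀ {i m} a c → m ≢ i → count i (a ++ m ∷ m ∷ c) ≡ count i (a ++ c)
count-middle-≢ {i} {m} []      c m≢i = trans (count-∷-≢ (m ∷ c) m≢i) (count-∷-≢ c m≢i)
count-middle-≢ {i} {m} (x ∷ a) c m≢i =
  cong ((if x ≡ᵇ i then 1 else 0) +_) (count-middle-≢ a c m≢i)

-- The Stirling condition

-- Meant for the word to the right of a letter `x`: a smaller letter followed by another `x` would
-- lie between two occurrences of `x`. The recursive form allows induction on the prefix before an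
-- insertion.
NoSmallerBetween : ℕ → Word → Set
NoSmallerBetween x []      = ⊤
NoSmallerBetween x (y ∷ w) = (y < x → x ∉ w) × NoSmallerBetween x w

Stirling : Word → Set
Stirling []      = ⊤
Stirling (x ∷ w) = NoSmallerBetween x w × Stirling w

-- The inserted letters exceed `x`, so they are neither forbidden smaller letters nor new
-- occurrences of `x`.
NSB-middle⁺ : ∀ {x m} a {c} → x < m → NoSmallerBetween x (a ++ c) → NoSmallerBetween x (a ++ m ∷ m ∷ c)
NSB-middle⁺ {x} {m} [] x<m ok = (contradiction′ , contradiction′ , ok)
  where
  contradiction′ : ∀ {C : Set} → m < x → C
  contradiction′ m<x = contradiction x<m (<-asym m<x)
NSB-middle⁺ {x} {m} (y ∷ a) {c} x<m (ok , oks) = x∉ , NSB-middle⁺ a x<m oks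
  where
  x∉ : y < x → x ∉ a ++ m ∷ m ∷ c
  x∉ y<x x∈ with ∈-++⁻ a x∈
  ... | inj₁ x∈a                 = ok y<x (∈-++⁺ˡ x∈a)
  ... | inj₂ (here refl)         = <-irrefl refl x<m
  ... | inj₂ (there (here refl)) = <-irrefl refl x<m
  ... | inj₂ (there (there x∈c)) = ok y<x (∈-++⁺ʳ a x∈c)

NSB-middle⁻ : ∀ {x m} a {c} → NoSmallerBetween x (a ++ m ∷ m ∷ c) → NoSmallerBetween x (a ++ c)
NSB-middle⁻ []              (_ , _ , ok) = ok
NSB-middle⁻ {x} {m} (y ∷ a) {c} (ok , oks) = x∉ , NSB-middle⁻ a oks
  where
  x∉ : y < x → x ∉ a ++ c
  x∉ y<x x∈ with ∈-++⁻ a x∈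
  ... | inj₁ x∈a = ok y<x (∈-++⁺ˡ x∈a)
  ... | inj₂ x∈c = ok y<x (∈-++⁺ʳ a (there (there x∈c)))

∉⇒NSB : ∀ {x} w → x ∉ w → NoSmallerBetween x w
∉⇒NSB []      x∉ = tt
∉⇒NSB (y ∷ w) x∉ = (λ _ → x∉ ∘ there) , ∉⇒NSB w (x∉ ∘ there)

Stirling-middle⁺ : ∀ {m} a {c} → All (_< m) (a ++ c) → Stirling (a ++ c) → Stirling (a ++ m ∷ m ∷ c)
Stirling-middle⁺ []      {c} all s =
  ((λ m<m → contradiction m<m (<-irrefl refl)) , m-ok) , m-ok , s
  where m-ok = ∉⇒NSB c (<⇒∉ all)
Stirling-middle⁺ (x ∷ a) (x<m ∷ all) (ok , s) = NSB-middle⁺ a x<m ok , Stirling-middle⁺ a all s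

Stirling-middle⁻ : ∀ {m} a {c} → Stirling (a ++ m ∷ m ∷ c) → Stirling (a ++ c)
Stirling-middle⁻ []      (_ , _ , s) = s
Stirling-middle⁻ (x ∷ a) (ok , s)    = NSB-middle⁻ a ok , Stirling-middle⁻ a s

-- Letters between the two copies of `m` are at least `m`, hence equal to `m`; as there are only two
-- copies, nothing stands between them.
maximum-adjacent : ∀ {m} w → All (_≤ m) w → Stirling w → count m w ≡ 2 →
                   ∃₂ λ a c → w ≡ a ++ m ∷ m ∷ c × All (_< m) (a ++ c)
maximum-adjacent {m} (x ∷ w) (x≤m ∷ all) (ok , s) c≡2 with x ≟ m
... | no x≢m with maximum-adjacent w all s (trans (sym (count-∷-≢ w x≢m)) c≡2)
...   | a , c , refl , all< = x ∷ a , c , refl , ≤∧≢⇒< x≤m x≢m ∷ all<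
maximum-adjacent {m} (.m ∷ w) (_ ∷ all) (ok , _) c≡2 | yes refl = second w all ok c≡1
  where
  c≡1 : count m w ≡ 1
  c≡1 = suc-injective (trans (sym (count-∷-≡ m w)) c≡2)

  second : ∀ w → All (_≤ m) w → NoSmallerBetween m w → count m w ≡ 1 →
           ∃₂ λ a c → m ∷ w ≡ a ++ m ∷ m ∷ c × All (_< m) (a ++ c)
  second (y ∷ w) (y≤m ∷ all) (ok , _) c≡1 with y ≟ m
  ... | yes refl = [] , w , refl ,
        ≤∧∉⇒< all (count≡0⇒∉ (suc-injective (trans (sym (count-∷-≡ m w)) c≡1)))
  ... | no y≢m   = contradiction
        (trans (sym c≡1) (trans (count-∷-≢ w y≢m) (∉⇒count≡0 w (ok (≤∧≢⇒< y≤m y≢m)))))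
        1+n≢0

-- The Stirling condition in terms of positions

at-∈ : ∀ w q → q < length w → at w q ∈ w
at-∈ (x ∷ w) zero    _       = here refl
at-∈ (x ∷ w) (suc q) (s<s q<) = there (at-∈ w q q<)

∈-at : ∀ {x w} → x ∈ w → ∃ λ q → q < length w × x ≡ at w q
∈-at (here refl) = 0 , z<s , refl
∈-at (there x∈) with ∈-at x∈
... | q , q< , eq = suc q , s<s q< , eq

NSB⇒at : ∀ {x} w → NoSmallerBetween x w → ∀ {q r} → r < q → q < length w → x ≡ at w q → x ≤ at w r
NSB⇒at {x} (y ∷ w) (ok , oks) {suc q} {zero} _ (s<s q<) eq =
  ≮⇒≥ (λ y<x → ok y<x (subst (_∈ w) (sym eq) (at-∈ w q q<)))
NSB⇒at (y ∷ w) (ok , oks) {suc q} {suc r} (s<s r<q) (s<s q<) eq = NSB⇒at w oks r<q q< eq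

at⇒NSB : ∀ {x} w → (∀ {q r} → r < q → q < length w → x ≡ at w q → x ≤ at w r) → NoSmallerBetween x w
at⇒NSB []      h = tt
at⇒NSB (y ∷ w) h =
  (λ y<x x∈w → let q , q< , eq = ∈-at x∈w in ≤⇒≯ (h z<s (s<s q<) eq) y<x) ,
  at⇒NSB w (λ r<q q< → h (s<s r<q) (s<s q<))

-- The condition that `isStirling` tests. The bound on `q` also bounds `p` and `r`, so `at` never
-- returns its default value 0 here.
StirlingAt : Word → Set
StirlingAt w = ∀ {p q r} → p < r → r < q → q < length w → at w p ≡ at w q → at w p ≤ at w r

Stirling⇒at : ∀ w → Stirling w → StirlingAt w
Stirling⇒at (x ∷ w) (ok , s) {zero}  {suc q} {suc r} _         (s<s r<q) (s<s q<) = NSB⇒at w ok r<q q<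
Stirling⇒at (x ∷ w) (ok , s) {suc p} {suc q} {suc r} (s<s p<r) (s<s r<q) (s<s q<) =
  Stirling⇒at w s p<r r<q q<

at⇒Stirling : ∀ w → StirlingAt w → Stirling w
at⇒Stirling []      h = tt
at⇒Stirling (x ∷ w) h =
  at⇒NSB w (λ r<q q< → h z<s (s<s r<q) (s<s q<)) ,
  at⇒Stirling w (λ p<r r<q q< → h (s<s p<r) (s<s r<q) (s<s q<))

allB⇒ : ∀ xs {f} → T (allB xs f) → ∀ {i} → i ∈ xs → T (f i)
allB⇒ (x ∷ xs) t (here refl) = proj₁ (to T-∧ t)
allB⇒ (x ∷ xs) t (there i∈)  = allB⇒ xs (proj₂ (to T-∧ t)) i∈

allB⇐ : ∀ xs {f} → (∀ {i} → i ∈ xs → T (f i)) → T (allB xs f)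
allB⇐ []       h = tt
allB⇐ (x ∷ xs) h = from T-∧ (h (here refl) , allB⇐ xs (h ∘ there))

T-implies⇒ : ∀ {a b} → T (not a ∨ b) → T a → T b
T-implies⇒ {true} t _ = t

T-implies⇐ : ∀ {a b} → (T a → T b) → T (not a ∨ b)
T-implies⇐ {true}  h = h tt
T-implies⇐ {false} h = tt

isStirling⇔ : ∀ w → T (isStirling w) ⇔ Stirling w
isStirling⇔ w = mk⇔
  (λ t → at⇒Stirling w (λ {p} {q} {r} p<r r<q q<L eq →
    let r<L = <-trans r<q q<L
        p<L = <-trans p<r r<L
    in ≤ᵇ⇒≤ _ _ (T-implies⇒ {(p <ᵇ r) ∧ (r <ᵇ q)}
         (allB⇒ (upTo L) (T-implies⇒ {(p <ᵇ q) ∧ (at w p ≡ᵇ at w q)}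
           (allB⇒ (upTo L) (allB⇒ (upTo L) t (∈-upTo⁺ p<L)) (∈-upTo⁺ q<L))
           (from T-∧ (<⇒<ᵇ (<-trans p<r r<q) , ≡⇒≡ᵇ _ _ eq)))
           (∈-upTo⁺ r<L))
         (from T-∧ (<⇒<ᵇ p<r , <⇒<ᵇ r<q)))))
  (λ s → allB⇐ (upTo L) λ {p} p∈ → allB⇐ (upTo L) λ {q} q∈ →
    T-implies⇐ {(p <ᵇ q) ∧ (at w p ≡ᵇ at w q)} λ t → allB⇐ (upTo L) λ {r} r∈ →
    T-implies⇐ {(p <ᵇ r) ∧ (r <ᵇ q)} λ t′ →
    ≤⇒≤ᵇ (Stirling⇒at w s (<ᵇ⇒< p r (proj₁ (to T-∧ t′))) (<ᵇ⇒< r q (proj₂ (to T-∧ t′)))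
           (∈-upTo⁻ q∈) (≡ᵇ⇒≡ _ _ (proj₂ (to T-∧ t)))))
  where L = length w

-- Stirling permutations of a multiset and the insertion of a new maximum

-- Common form of `Qset` (constant `μ = 2`, `L = 2 * n`) and `Q1set` (`μ = mult1`, `L = 2 * n ∸ 1`);
-- `μ i` is the multiplicity of the letter `suc i`.
stirlingPerms : (ℕ → ℕ) → ℕ → ℕ → List Word
stirlingPerms μ n L =
  filterᵇ (λ w → isStirling w ∧ allB (upTo n) (λ i → count (suc i) w ≡ᵇ μ i)) (words n L)

record IsStirlingPerm (μ : ℕ → ℕ) (n L : ℕ) (w : Word) : Set where
  field
    has-length : length w ≡ L
    letters    : All (Letter n) w
    stirling   : Stirling w
    counts     : ∀ {i} → i < n → count (suc i) w ≡ μ i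

open IsStirlingPerm

stirlingPerms-unique : ∀ μ n L → Unique (stirlingPerms μ n L)
stirlingPerms-unique μ n L =
  subst Unique (sym (filterᵇ≡filter _ (words n L))) (Unique.filter⁺ (T? ∘ _) (words-unique n L))

∈-stirlingPerms⇒ : ∀ {μ n L w} → w ∈ stirlingPerms μ n L → IsStirlingPerm μ n L w
∈-stirlingPerms⇒ {μ} {n} {L} {w} w∈
  with ∈-filter⁻ (T? ∘ _) {xs = words n L} (subst (w ∈_) (filterᵇ≡filter _ (words n L)) w∈)
... | w∈words , t with ∈-words⇒ n L w∈words
... | len , all = record
  { has-length = len
  ; letters    = all
  ; stirling   = to (isStirling⇔ w) (proj₁ (to T-∧ t))
  ; counts     = λ i<n → ≡ᵇ⇒≡ _ _ (allB⇒ (upTo n) (proj₂ (to T-∧ t)) (∈-upTo⁺ i<n))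
  }

∈-stirlingPerms⇐ : ∀ {μ n L w} → IsStirlingPerm μ n L w → w ∈ stirlingPerms μ n L
∈-stirlingPerms⇐ {μ} {n} {L} {w} p with has-length p
... | refl = subst (w ∈_) (sym (filterᵇ≡filter _ (words n L)))
  (∈-filter⁺ (T? ∘ _) (∈-words⇐ n (letters p))
    (from T-∧ (from (isStirling⇔ w) (stirling p) ,
               allB⇐ (upTo n) (λ i∈ → ≡⇒≡ᵇ _ _ (counts p (∈-upTo⁻ i∈))))))

-- One entry for each of the `length u + 1` gaps of `u`, both ends included, from left to right.
inserts : ℕ → Word → List Word
inserts m []      = (m ∷ m ∷ []) ∷ []
inserts m (x ∷ u) = (m ∷ m ∷ x ∷ u) ∷ map (x ∷_) (inserts m u)

∈-inserts⇒ : ∀ {m} u {w} → w ∈ inserts m u → ∃₂ λ a c → u ≡ a ++ c × w ≡ a ++ m ∷ m ∷ c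
∈-inserts⇒ []      (here refl) = [] , [] , refl , refl
∈-inserts⇒ (x ∷ u) (here refl) = [] , x ∷ u , refl , refl
∈-inserts⇒ (x ∷ u) (there w∈) with ∈-map⁻ (x ∷_) w∈
... | v , v∈ , refl with ∈-inserts⇒ u v∈
... | a , c , refl , refl = x ∷ a , c , refl , refl

∈-inserts⇐ : ∀ {m} a {c} → a ++ m ∷ m ∷ c ∈ inserts m (a ++ c)
∈-inserts⇐ []      {[]}    = here refl
∈-inserts⇐ []      {x ∷ c} = here refl
∈-inserts⇐ (x ∷ a)         = there (∈-map⁺ (x ∷_) (∈-inserts⇐ a))

_≢?_ : ∀ x m → Dec (x ≢ m)
x ≢? m = ¬? (x ≟ m)

remove : ℕ → Word → Word
remove m = filter (_≢? m)

-- Since `u` has no letter `m`, filtering deletes exactly the inserted pair. This is the left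
-- inverse that `concatMap-unique` asks for.
remove-inserts : ∀ {m u w} → All (_< m) u → w ∈ inserts m u → remove m w ≡ u
remove-inserts {m} {u} all w∈ with ∈-inserts⇒ u w∈
... | a , c , refl , refl = go a all
  where
  go : ∀ a → All (_< m) (a ++ c) → remove m (a ++ m ∷ m ∷ c) ≡ a ++ c
  go []      all         = begin
    remove m (m ∷ m ∷ c)  ≡⟨ filter-reject (_≢? m) (λ m≢m → m≢m refl) ⟩
    remove m (m ∷ c)      ≡⟨ filter-reject (_≢? m) (λ m≢m → m≢m refl) ⟩
    remove m c            ≡⟨ filter-all (_≢? m) (All.map <⇒≢ all) ⟩
    c                     ∎
  go (x ∷ a) (x<m ∷ all) = trans (filter-accept (_≢? m) (<⇒≢ x<m)) (cong (x ∷_) (go a all))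

-- Insertion at the front yields a word starting with `m`; all other insertions keep the first
-- letter `x < m`.
inserts-unique : ∀ {m} u → All (_< m) u → Unique (inserts m u)
inserts-unique         []      _           = [] ∷ []
inserts-unique {m} (x ∷ u) (x<m ∷ all) =
  All.tabulate head∉ ∷ Unique.map⁺ ∷-injectiveʳ (inserts-unique u all)
  where
  head∉ : ∀ {w} → w ∈ map (x ∷_) (inserts m u) → m ∷ m ∷ x ∷ u ≢ w
  head∉ w∈ refl with ∈-map⁻ (x ∷_) w∈
  ... | _ , _ , eq = <-irrefl (sym (∷-injectiveˡ eq)) x<m

module _ {μ : ℕ → ℕ} {n L : ℕ} where

  letters-< : ∀ {u} → u ∈ stirlingPerms μ n L → All (_< suc n) u
  letters-< u∈ = All.map (s≤s ∘ proj₂) (letters (∈-stirlingPerms⇒ {μ} {n} {L} u∈))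

  insert-maximum : ∀ a {c} → μ n ≡ 2 → IsStirlingPerm μ n L (a ++ c) →
                   IsStirlingPerm μ (suc n) (2 + L) (a ++ suc n ∷ suc n ∷ c)
  insert-maximum a {c} μn≡2 p = record
    { has-length = trans (length-middle (suc n) a c) (cong (2 +_) (has-length p))
    ; letters    = All-middle⁺ a (z<s , ≤-refl) (All.map (λ (l , r) → l , m≤n⇒m≤1+n r) (letters p))
    ; stirling   = Stirling-middle⁺ a all< (stirling p)
    ; counts     = λ {i} → counts′ i
    }
    where
    all< : All (_< suc n) (a ++ c)
    all< = All.map (s≤s ∘ proj₂) (letters p)

    counts′ : ∀ i → i < suc n → count (suc i) (a ++ suc n ∷ suc n ∷ c) ≡ μ i
    counts′ i i<1+n with i ≟ n
    ... | yes refl = trans (count-middle-≡ (suc n) a c)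
                      (trans (cong (2 +_) (∉⇒count≡0 (a ++ c) (<⇒∉ all<))) (sym μn≡2))
    ... | no i≢n   = trans (count-middle-≢ a c (i≢n ∘ sym ∘ suc-injective))
                      (counts p (≤∧≢⇒< (s≤s⁻¹ i<1+n) i≢n))

  remove-maximum : ∀ {w} → μ n ≡ 2 → IsStirlingPerm μ (suc n) (2 + L) w →
                   ∃₂ λ a c → w ≡ a ++ suc n ∷ suc n ∷ c × IsStirlingPerm μ n L (a ++ c)
  remove-maximum {w} μn≡2 p
    with maximum-adjacent w (All.map proj₂ (letters p)) (stirling p) (trans (counts p ≤-refl) μn≡2)
  ... | a , c , refl , all< = a , c , refl , record
    { has-length = suc-injective (suc-injective (trans (sym (length-middle (suc n) a c)) (has-length p)))
    ; letters    = All.zipWith (λ ((l , _) , r) → l , s≤s⁻¹ r) (All-middle⁻ a (letters p) , all<)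
    ; stirling   = Stirling-middle⁻ a (stirling p)
    ; counts     = λ i<n → trans (sym (count-middle-≢ a c (<⇒≢ i<n ∘ sym ∘ suc-injective)))
                                 (counts p (m≤n⇒m≤1+n i<n))
    }

  -- Both lists are free of repetitions, so it suffices to compare members: `remove-maximum` gives
  -- one inclusion and `insert-maximum` the other.
  stirlingPerms-suc : μ n ≡ 2 →
    stirlingPerms μ (suc n) (2 + L) ↭ concatMap (inserts (suc n)) (stirlingPerms μ n L)
  stirlingPerms-suc μn≡2 = unique⇔⇒↭
    (stirlingPerms-unique μ (suc n) (2 + L))
    (concatMap-unique (inserts (suc n)) (remove (suc n))
      (λ u∈ → inserts-unique _ (letters-< u∈))
      (λ u∈ → remove-inserts (letters-< u∈))
      (stirlingPerms-unique μ n L))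
    (mk⇔ split join)
    where
    split : ∀ {w} → w ∈ stirlingPerms μ (suc n) (2 + L) →
            w ∈ concatMap (inserts (suc n)) (stirlingPerms μ n L)
    split w∈ with remove-maximum μn≡2 (∈-stirlingPerms⇒ w∈)
    ... | a , c , refl , p = ∈-concatMap⇐ (inserts (suc n)) (∈-stirlingPerms⇐ p) (∈-inserts⇐ a)

    join : ∀ {w} → w ∈ concatMap (inserts (suc n)) (stirlingPerms μ n L) →
           w ∈ stirlingPerms μ (suc n) (2 + L)
    join w∈ with ∈-concatMap⇒ (inserts (suc n)) (stirlingPerms μ n L) w∈
    ... | u , u∈ , w∈u with ∈-inserts⇒ u w∈u
    ... | a , c , refl , refl = ∈-stirlingPerms⇐ (insert-maximum a μn≡2 (∈-stirlingPerms⇒ u∈))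

-- The derivation on exponent triples

Mon : Set
Mon = ℕ × ℕ × ℕ

infixl 7 _·_

_·_ : Mon → Mon → Mon
(a , b , c) · (a′ , b′ , c′) = a + a′ , b + b′ , c + c′

D : (Mon → ℕ) → Mon → ℕ
D f (a , b , c) =
  a * f (a , suc b , suc c) + (b * f (suc a , b , suc c) + c * f (suc a , suc b , c))

-- The factors `a + a′`, `b + b′`, `c + c′` split additively, and raising an exponent in either
-- factor raises it equally in the product.
leibniz : ∀ f s t → D f (s · t) ≡ D (λ s′ → f (s′ · t)) s + D (λ t′ → f (s · t′)) t
leibniz f (a , b , c) (a′ , b′ , c′)
  rewrite +-suc a a′ | +-suc b b′ | +-suc c c′ = rearrange a a′ b b′ c c′ _ _ _
  where
  rearrange : ∀ a a′ b b′ c c′ x y z →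
    (a + a′) * x + ((b + b′) * y + (c + c′) * z) ≡
    (a * x + (b * y + c * z)) + (a′ * x + (b′ * y + c′ * z))
  rearrange = solve-∀

Dⁿ : ℕ → (Mon → ℕ) → Mon → ℕ
Dⁿ zero    f = f
Dⁿ (suc n) f = Dⁿ n (D f)

-- Types of adjacent pairs and how an insertion changes them

pairType : ℕ → ℕ → Mon
pairType x y =
  (if x <ᵇ y then 1 else 0) , (if y <ᵇ x then 1 else 0) , (if x ≡ᵇ y then 1 else 0)

pairType-< : ∀ {x y} → x < y → pairType x y ≡ (1 , 0 , 0)
pairType-< z<s                 = refl
pairType-< (s<s x<y@(s≤s _))   = pairType-< x<y

pairType-≡ : ∀ x → pairType x x ≡ (0 , 0 , 1)
pairType-≡ zero    = refl
pairType-≡ (suc x) = pairType-≡ x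

pairType-> : ∀ {x y} → y < x → pairType x y ≡ (0 , 1 , 0)
pairType-> z<s               = refl
pairType-> (s<s y<x@(s≤s _)) = pairType-> y<x

-- A single gap contributes one variable, and the derivation sends each of x, y and z to xyz.
D-pairType : ∀ f x y → D f (pairType x y) ≡ f (1 , 1 , 1)
D-pairType f x y with <-cmp x y
... | tri< x<y _ _  = trans (cong (D f) (pairType-< x<y)) (trans (+-identityʳ _) (+-identityʳ _))
... | tri≈ _ refl _ = trans (cong (D f) (pairType-≡ x)) (+-identityʳ _)
... | tri> _ _ y<x  = trans (cong (D f) (pairType-> y<x)) (trans (+-identityʳ _) (+-identityʳ _))

-- By computation, `pairTypes (x ∷ y ∷ w)` is `pairType x y · pairTypes (y ∷ w)`: the monomial of a
-- word is the product over its gaps, which is what makes `leibniz` applicable.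
pairTypes : Word → Mon
pairTypes w =
  countPairs (λ a b → a <ᵇ b) w , countPairs (λ a b → b <ᵇ a) w , countPairs (λ a b → a ≡ᵇ b) w

stats : Word → Mon
stats w = asc w , des w , plat w

pairTypes-insert : ∀ {m x y} w → x < m → y < m →
  pairTypes (x ∷ m ∷ m ∷ y ∷ w) ≡ (1 , 1 , 1) · pairTypes (y ∷ w)
pairTypes-insert {m} {x} {y} w x<m y<m =
  cong₂ _·_ (pairType-< x<m) (cong₂ _·_ (pairType-≡ m) (cong (_· pairTypes (y ∷ w)) (pairType-> y<m)))

-- Here `x` is the letter to the left of `u`. Inserting into the first gap differentiates the factor
-- of that gap, the remaining insertions differentiate the product of the other factors by
-- induction, and `leibniz` adds the two.
∑-inserts : ∀ {m x} u f → 0 < m → x < m → All (_< m) u →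
            ∑ (λ w → f (pairTypes (x ∷ w ++ 0 ∷ []))) (inserts m u) ≡ D f (pairTypes (x ∷ u ++ 0 ∷ []))
∑-inserts {m} {x} [] f 0<m x<m [] = begin
  f (pairTypes (x ∷ m ∷ m ∷ 0 ∷ [])) + 0
    ≡⟨ cong (λ t → f t + 0) (pairTypes-insert [] x<m 0<m) ⟩
  f (1 , 1 , 1) + 0
    ≡⟨ cong (_+ 0) (sym (D-pairType (λ s → f (s · (0 , 0 , 0))) x 0)) ⟩
  D (λ s → f (s · (0 , 0 , 0))) (pairType x 0) + 0
    -- `D` vanishes at the exponents `(0 , 0 , 0)` of the constant monomial, which accounts for the
    -- summand 0.
    ≡⟨ sym (leibniz f (pairType x 0) (0 , 0 , 0)) ⟩
  D f (pairTypes (x ∷ 0 ∷ [])) ∎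
∑-inserts {m} {x} (y ∷ u) f 0<m x<m (y<m ∷ all) = begin
  f (pairTypes (x ∷ m ∷ m ∷ y ∷ u0)) + ∑ (λ w → f (pairTypes (x ∷ w ++ 0 ∷ []))) (map (y ∷_) (inserts m u))
    ≡⟨ cong₂ _+_ (cong f (pairTypes-insert u0 x<m y<m)) (∑-map _ (y ∷_) (inserts m u)) ⟩
  f ((1 , 1 , 1) · t) + ∑ (λ w → f (pairType x y · pairTypes (y ∷ w ++ 0 ∷ []))) (inserts m u)
    ≡⟨ cong₂ _+_ (sym (D-pairType (λ s → f (s · t)) x y))
                 (∑-inserts u (λ t′ → f (pairType x y · t′)) 0<m y<m all) ⟩
  D (λ s → f (s · t)) (pairType x y) + D (λ t′ → f (pairType x y · t′)) t
    ≡⟨ sym (leibniz f (pairType x y) t) ⟩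
  D f (pairTypes (x ∷ y ∷ u0)) ∎
  where
  u0 = u ++ 0 ∷ []
  t  = pairTypes (y ∷ u0)

∑-stirlingPerms-suc : ∀ μ n L f → μ n ≡ 2 →
  ∑ (f ∘ stats) (stirlingPerms μ (suc n) (2 + L)) ≡ ∑ (D f ∘ stats) (stirlingPerms μ n L)
∑-stirlingPerms-suc μ n L f μn≡2 = begin
  ∑ (f ∘ stats) (stirlingPerms μ (suc n) (2 + L))
    ≡⟨ ∑-↭ (f ∘ stats) (stirlingPerms-suc {μ} {n} {L} μn≡2) ⟩
  ∑ (f ∘ stats) (concatMap (inserts (suc n)) (stirlingPerms μ n L))
    ≡⟨ ∑-concatMap (f ∘ stats) (inserts (suc n)) (stirlingPerms μ n L) ⟩
  ∑ (∑ (f ∘ stats) ∘ inserts (suc n)) (stirlingPerms μ n L)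
    -- The two proofs `z<s` say that the closing and the opening padding zero lie below the new
    -- maximum.
    ≡⟨ ∑-cong-∈ (stirlingPerms μ n L) (λ {u} u∈ → ∑-inserts u f z<s z<s (letters-< {μ} {n} {L} u∈)) ⟩
  ∑ (D f ∘ stats) (stirlingPerms μ n L) ∎

-- The exponents of the monomials of C_k and of E_{l+1}, with multiplicity.
C-terms : ℕ → List Mon
C-terms zero    = (1 , 0 , 0) ∷ []
C-terms (suc k) = map stats (Qset (suc k))

-- In `Epoly` the variable x marks plateaus and z marks ascents, opposite to the order in `stats`.
reverse³ : Mon → Mon
reverse³ (a , b , c) = c , b , a

E-terms : ℕ → List Mon
E-terms l = map (reverse³ ∘ stats) (Q1set (suc l))

C-terms-suc : ∀ k f → ∑ f (C-terms (suc k)) ≡ ∑ (D f) (C-terms k)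
-- The exponents of C_0 = x are `pairType 0 1`, while `Qset 1` evaluates to the single word 11 with
-- monomial xyz; the convention for C_0 thus fits the recurrence.
C-terms-suc zero    f = sym (cong (_+ 0) (D-pairType f 0 1))
C-terms-suc (suc k) f = begin
  ∑ f (map stats (stirlingPerms twice (2 + k) (2 * (2 + k))))
    ≡⟨ ∑-map f stats (stirlingPerms twice (2 + k) (2 * (2 + k))) ⟩
  ∑ (f ∘ stats) (stirlingPerms twice (2 + k) (2 * (2 + k)))
    ≡⟨ cong (∑ (f ∘ stats) ∘ stirlingPerms twice (2 + k)) (*-suc 2 (suc k)) ⟩
  ∑ (f ∘ stats) (stirlingPerms twice (2 + k) (2 + 2 * suc k))
    ≡⟨ ∑-stirlingPerms-suc twice (suc k) (2 * suc k) f refl ⟩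
  ∑ (D f ∘ stats) (stirlingPerms twice (suc k) (2 * suc k))
    ≡⟨ sym (∑-map (D f) stats (stirlingPerms twice (suc k) (2 * suc k))) ⟩
  ∑ (D f) (map stats (stirlingPerms twice (suc k) (2 * suc k))) ∎
  where
  twice : ℕ → ℕ
  twice _ = 2

-- The derivation is symmetric in the three variables.
D-reverse³ : ∀ f t → D (f ∘ reverse³) t ≡ D f (reverse³ t)
D-reverse³ f (a , b , c) = rearrange (a * _) (b * _) (c * _)
  where
  rearrange : ∀ x y z → x + (y + z) ≡ z + (y + x)
  rearrange = solve-∀

E-terms-suc : ∀ l f → ∑ f (E-terms (suc l)) ≡ ∑ (D f) (E-terms l)
E-terms-suc l f = begin
  ∑ f (map (reverse³ ∘ stats) (stirlingPerms mult1 (2 + l) (2 * (2 + l) ∸ 1)))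
    ≡⟨ ∑-map f (reverse³ ∘ stats) (Q1set (2 + l)) ⟩
  ∑ (f ∘ reverse³ ∘ stats) (stirlingPerms mult1 (2 + l) (2 * (2 + l) ∸ 1))
    -- As `2 * suc l` is a successor, subtracting 1 commutes with adding 2 by computation.
    ≡⟨ cong (λ L → ∑ (f ∘ reverse³ ∘ stats) (stirlingPerms mult1 (2 + l) (L ∸ 1))) (*-suc 2 (suc l)) ⟩
  ∑ (f ∘ reverse³ ∘ stats) (stirlingPerms mult1 (2 + l) (2 + (2 * suc l ∸ 1)))
    ≡⟨ ∑-stirlingPerms-suc mult1 (suc l) (2 * suc l ∸ 1) (f ∘ reverse³) refl ⟩
  ∑ (D (f ∘ reverse³) ∘ stats) (Q1set (suc l))
    ≡⟨ ∑-cong (Q1set (suc l)) (D-reverse³ f ∘ stats) ⟩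
  ∑ (D f ∘ reverse³ ∘ stats) (Q1set (suc l))
    ≡⟨ sym (∑-map (D f) (reverse³ ∘ stats) (Q1set (suc l))) ⟩
  ∑ (D f) (E-terms l) ∎

-- Iterating the derivation on the product of C_k and E_{l+1}

C-terms-Dⁿ : ∀ n f → ∑ f (C-terms (suc n)) ≡ ∑ (Dⁿ n f) (C-terms 1)
C-terms-Dⁿ zero    f = refl
C-terms-Dⁿ (suc n) f = trans (C-terms-suc (suc n) f) (C-terms-Dⁿ n (D f))

-- The pairing of `f` with the terms of the product C_k E_{l+1}; for `f = δ³ a b c` it is a
-- coefficient of that product.
∑CE : ℕ → ℕ → (Mon → ℕ) → ℕ
∑CE k l f = ∑ (λ s → ∑ (λ t → f (s · t)) (E-terms l)) (C-terms k)

-- After `leibniz` is applied to every pair of terms, the recurrence for E absorbs one half. For the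
-- other half the sums are exchanged, so that `t` is fixed while the recurrence for C acts on the
-- sum over `s`.
∑CE-D : ∀ k l f → ∑CE k l (D f) ≡ ∑CE (suc k) l f + ∑CE k (suc l) f
∑CE-D k l f = begin
  ∑ (λ s → ∑ (λ t → D f (s · t)) E) K
    ≡⟨ ∑-cong K (λ s → trans (∑-cong E (leibniz f s)) (∑-+ _ _ E)) ⟩
  ∑ (λ s → ∑ (λ t → D (λ s′ → f (s′ · t)) s) E + ∑ (D (λ t′ → f (s · t′))) E) K
    ≡⟨ ∑-+ _ _ K ⟩
  ∑ (λ s → ∑ (λ t → D (λ s′ → f (s′ · t)) s) E) K + ∑ (λ s → ∑ (D (λ t′ → f (s · t′))) E) K
    ≡⟨ cong₂ _+_ left (∑-cong K (λ s → sym (E-terms-suc l (λ t′ → f (s · t′))))) ⟩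
  ∑CE (suc k) l f + ∑CE k (suc l) f ∎
  where
  K = C-terms k
  E = E-terms l

  left : ∑ (λ s → ∑ (λ t → D (λ s′ → f (s′ · t)) s) E) K ≡ ∑CE (suc k) l f
  left = begin
    ∑ (λ s → ∑ (λ t → D (λ s′ → f (s′ · t)) s) E) K    ≡⟨ ∑-swap _ K E ⟩
    ∑ (λ t → ∑ (D (λ s′ → f (s′ · t))) K) E            ≡⟨ ∑-cong E (λ t → sym (C-terms-suc k (λ s′ → f (s′ · t)))) ⟩
    ∑ (λ t → ∑ (λ s′ → f (s′ · t)) (C-terms (suc k))) E  ≡⟨ ∑-swap _ E (C-terms (suc k)) ⟩
    ∑CE (suc k) l f                                    ∎

nC0≡1 : ∀ n → n C 0 ≡ 1
nC0≡1 n = trans (nCk≡nC[n∸k] {0} {n} z≤n) (nCn≡1 n)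

pascal-sum : ∀ n (a : ℕ → ℕ) →
  Σ≤ n (λ k → (n C k) * a (suc k)) + Σ≤ n (λ k → (n C k) * a k) ≡ Σ≤ (suc n) (λ k → (suc n C k) * a k)
pascal-sum n a = begin
  S + Σ≤ n b
    ≡⟨ cong (S +_) (sym (+-identityʳ (Σ≤ n b))) ⟩
  S + (Σ≤ n b + 0)
    -- A top term with the vanishing coefficient `n C suc n` is added, so that splitting off the
    -- first term leaves a shifted sum again of length `n`.
    ≡⟨ cong (λ z → S + (Σ≤ n b + z * a (suc n))) (sym (k>n⇒nCk≡0 (n<1+n n))) ⟩
  S + Σ≤ (suc n) b
    ≡⟨ cong (S +_) (Σ≤-head n _) ⟩
  S + ((n C 0) * a 0 + S′)
    ≡⟨ rearrange S _ S′ ⟩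
  (n C 0) * a 0 + (S + S′)
    ≡⟨ cong₂ _+_ (cong (_* a 0) (trans (nC0≡1 n) (sym (nC0≡1 (suc n))))) (sym (Σ≤-+ n _ _)) ⟩
  (suc n C 0) * a 0 + Σ≤ n (λ k → (n C k) * a (suc k) + (n C suc k) * a (suc k))
    ≡⟨ cong ((suc n C 0) * a 0 +_) (Σ≤-cong n (λ k →
         trans (sym (*-distribʳ-+ (a (suc k)) (n C k) (n C suc k)))
               (cong (_* a (suc k)) (nCk+nC[k+1]≡[n+1]C[k+1] n k)))) ⟩
  (suc n C 0) * a 0 + Σ≤ n (λ k → (suc n C suc k) * a (suc k))
    ≡⟨ sym (Σ≤-head n _) ⟩
  Σ≤ (suc n) (λ k → (suc n C k) * a k) ∎
  where
  b  = λ k → (n C k) * a k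
  S  = Σ≤ n (λ k → (n C k) * a (suc k))
  S′ = Σ≤ n (λ k → (n C suc k) * a (suc k))

  rearrange : ∀ x y z → x + (y + z) ≡ y + (x + z)
  rearrange = solve-∀

∑CE-Dⁿ : ∀ n f → ∑CE 0 0 (Dⁿ n f) ≡ Σ≤ n (λ k → (n C k) * ∑CE k (n ∸ k) f)
∑CE-Dⁿ zero    f = sym (*-identityˡ _)
∑CE-Dⁿ (suc n) f = begin
  ∑CE 0 0 (Dⁿ n (D f))
    ≡⟨ ∑CE-Dⁿ n (D f) ⟩
  Σ≤ n (λ k → (n C k) * ∑CE k (n ∸ k) (D f))
    ≡⟨ Σ≤-cong-≤ n (λ {k} k≤n → trans (cong ((n C k) *_) (step k≤n)) (*-distribˡ-+ (n C k) (a (suc k)) (a k))) ⟩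
  Σ≤ n (λ k → (n C k) * a (suc k) + (n C k) * a k)
    ≡⟨ Σ≤-+ n _ _ ⟩
  Σ≤ n (λ k → (n C k) * a (suc k)) + Σ≤ n (λ k → (n C k) * a k)
    ≡⟨ pascal-sum n a ⟩
  Σ≤ (suc n) (λ k → (suc n C k) * a k) ∎
  where
  a : ℕ → ℕ
  a k = ∑CE k (suc n ∸ k) f

  -- With truncated subtraction, `suc (n ∸ k)` agrees with `suc n ∸ k` only for `k ≤ n`, hence the
  -- bounded congruence `Σ≤-cong-≤` above.
  step : ∀ {k} → k ≤ n → ∑CE k (n ∸ k) (D f) ≡ a (suc k) + a k
  step {k} k≤n = trans (∑CE-D k (n ∸ k) f)
    (cong (λ l → a (suc k) + ∑CE k l f) (sym (+-∸-assoc 1 k≤n)))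

-- Coefficients

-- The coefficient of x^a in x^p; summing `δ³ a b c` over a list of exponent triples thus reads off
-- a coefficient.
δ : ℕ → ℕ → ℕ
δ a p = if p ≡ᵇ a then 1 else 0

δ³ : ℕ → ℕ → ℕ → Mon → ℕ
δ³ a b c (p , q , r) = δ a p * (δ b q * δ c r)

-- The coefficient form of x^p x^q = x^(p+q). Lowering `a` and `p` together shifts the summation
-- index by one.
δ-convolution : ∀ a p q → Σ≤ a (λ i → δ i p * δ (a ∸ i) q) ≡ δ a (p + q)
δ-convolution zero    zero    q = +-identityʳ _
δ-convolution zero    (suc p) q = refl
δ-convolution (suc a) zero    q = begin
  Σ≤ (suc a) (λ i → δ i 0 * δ (suc a ∸ i) q)  ≡⟨ Σ≤-head a _ ⟩
  (δ (suc a) q + 0) + Σ≤ a (λ _ → 0)          ≡⟨ cong₂ _+_ (+-identityʳ _) (Σ≤-zero a) ⟩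
  δ (suc a) q + 0                             ≡⟨ +-identityʳ _ ⟩
  δ (suc a) q                                 ∎
δ-convolution (suc a) (suc p) q = trans (Σ≤-head a _) (δ-convolution a p q)

-- The summand is a product of one factor in each of `i`, `j`, `k`, so the triple sum splits into
-- three one-variable convolutions.
δ³-convolution : ∀ a b c s t →
  Σ≤ a (λ i → Σ≤ b (λ j → Σ≤ c (λ k → δ³ i j k s * δ³ (a ∸ i) (b ∸ j) (c ∸ k) t))) ≡ δ³ a b c (s · t)
δ³-convolution a b c (p , q , r) (p′ , q′ , r′) = begin
  Σ≤ a (λ i → Σ≤ b (λ j → Σ≤ c (λ k →
    (δ i p * (δ j q * δ k r)) * (δ (a ∸ i) p′ * (δ (b ∸ j) q′ * δ (c ∸ k) r′)))))
    ≡⟨ (Σ≤-cong a λ i → Σ≤-cong b λ j → trans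
          (Σ≤-cong c (λ k → interchange (δ i p) (δ j q) (δ k r) (δ (a ∸ i) p′) (δ (b ∸ j) q′) (δ (c ∸ k) r′)))
          (trans (Σ≤-*ˡ c (P i * Q j) R) (*-assoc (P i) (Q j) (Σ≤ c R)))) ⟩
  Σ≤ a (λ i → Σ≤ b (λ j → P i * (Q j * Σ≤ c R)))
    ≡⟨ (Σ≤-cong a λ i → trans (Σ≤-*ˡ b (P i) _) (cong (P i *_) (Σ≤-*ʳ b (Σ≤ c R) Q))) ⟩
  Σ≤ a (λ i → P i * (Σ≤ b Q * Σ≤ c R))
    ≡⟨ Σ≤-*ʳ a _ P ⟩
  Σ≤ a P * (Σ≤ b Q * Σ≤ c R)
    ≡⟨ cong₂ _*_ (δ-convolution a p p′) (cong₂ _*_ (δ-convolution b q q′) (δ-convolution c r r′)) ⟩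
  δ a (p + p′) * (δ b (q + q′) * δ c (r + r′)) ∎
  where
  P = λ i → δ i p * δ (a ∸ i) p′
  Q = λ j → δ j q * δ (b ∸ j) q′
  R = λ k → δ k r * δ (c ∸ k) r′

  interchange : ∀ x y z x′ y′ z′ →
    (x * (y * z)) * (x′ * (y′ * z′)) ≡ ((x * x′) * (y * y′)) * (z * z′)
  interchange = solve-∀

if-∧-* : ∀ x y z → (if x ∧ y ∧ z then 1 else 0) ≡
  (if x then 1 else 0) * ((if y then 1 else 0) * (if z then 1 else 0))
if-∧-* false y     z     = refl
if-∧-* true  false z     = refl
if-∧-* true  true  true  = refl
if-∧-* true  true  false = refl

genPoly≡∑ : ∀ s₁ s₂ s₃ ws a b c →
  genPoly s₁ s₂ s₃ ws a b c ≡ ∑ (δ³ a b c) (map (λ w → s₁ w , s₂ w , s₃ w) ws)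
genPoly≡∑ s₁ s₂ s₃ ws a b c = begin
  genPoly s₁ s₂ s₃ ws a b c
    ≡⟨ ∑-filterᵇ _ ws ⟩
  ∑ (λ w → if (s₁ w ≡ᵇ a) ∧ (s₂ w ≡ᵇ b) ∧ (s₃ w ≡ᵇ c) then 1 else 0) ws
    ≡⟨ ∑-cong ws (λ w → if-∧-* (s₁ w ≡ᵇ a) (s₂ w ≡ᵇ b) (s₃ w ≡ᵇ c)) ⟩
  ∑ (λ w → δ³ a b c (s₁ w , s₂ w , s₃ w)) ws
    ≡⟨ sym (∑-map (δ³ a b c) _ ws) ⟩
  ∑ (δ³ a b c) (map (λ w → s₁ w , s₂ w , s₃ w) ws) ∎

Cpoly≡∑ : ∀ k a b c → Cpoly k a b c ≡ ∑ (δ³ a b c) (C-terms k)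
Cpoly≡∑ zero    zero          b       c       = refl
Cpoly≡∑ zero    (suc (suc a)) b       c       = refl
Cpoly≡∑ zero    (suc zero)    (suc b) c       = refl
Cpoly≡∑ zero    (suc zero)    zero    (suc c) = refl
Cpoly≡∑ zero    (suc zero)    zero    zero    = refl
Cpoly≡∑ (suc k) a             b       c       = genPoly≡∑ asc des plat (Qset (suc k)) a b c

Epoly≡∑ : ∀ l a b c → Epoly (suc l) a b c ≡ ∑ (δ³ a b c) (E-terms l)
Epoly≡∑ l = genPoly≡∑ plat des asc (Q1set (suc l))

-- Both factors are sums of monomials, so by bilinearity the convolution moves inside the sums over
-- terms, where it acts on a single pair of monomials.
CE≡∑ : ∀ k l a b c → (Cpoly k ⊗ Epoly (suc l)) a b c ≡ ∑CE k l (δ³ a b c)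
CE≡∑ k l a b c = begin
  Σ≤ a (λ i → Σ≤ b (λ j → Σ≤ c (λ m → Cpoly k i j m * Epoly (suc l) (a ∸ i) (b ∸ j) (c ∸ m))))
    ≡⟨ (Σ≤-cong a λ i → Σ≤-cong b λ j → Σ≤-cong c λ m → trans
          (cong₂ _*_ (Cpoly≡∑ k i j m) (Epoly≡∑ l (a ∸ i) (b ∸ j) (c ∸ m)))
          (∑-*-∑ (δ³ i j m) (δ³ (a ∸ i) (b ∸ j) (c ∸ m)) K E)) ⟩
  Σ≤ a (λ i → Σ≤ b (λ j → Σ≤ c (λ m → ∑ (λ s → ∑ (λ t → F i j m s t) E) K)))
    ≡⟨ (Σ≤-cong a λ i → Σ≤-cong b λ j → Σ≤-∑∑-swap c (F i j) K E) ⟩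
  Σ≤ a (λ i → Σ≤ b (λ j → ∑ (λ s → ∑ (λ t → Σ≤ c (λ m → F i j m s t)) E) K))
    ≡⟨ (Σ≤-cong a λ i → Σ≤-∑∑-swap b _ K E) ⟩
  Σ≤ a (λ i → ∑ (λ s → ∑ (λ t → Σ≤ b (λ j → Σ≤ c (λ m → F i j m s t))) E) K)
    ≡⟨ Σ≤-∑∑-swap a _ K E ⟩
  ∑ (λ s → ∑ (λ t → Σ≤ a (λ i → Σ≤ b (λ j → Σ≤ c (λ m → F i j m s t)))) E) K
    ≡⟨ ∑-cong K (λ s → ∑-cong E (δ³-convolution a b c s)) ⟩
  ∑CE k l (δ³ a b c) ∎
  where
  K = C-terms k
  E = E-terms l

  F : ℕ → ℕ → ℕ → Mon → Mon → ℕ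
  F i j m s t = δ³ i j m s * δ³ (a ∸ i) (b ∸ j) (c ∸ m) t

ΣP≡Σ≤ : ∀ n F a b c → ΣP n F a b c ≡ Σ≤ n (λ k → F k a b c)
ΣP≡Σ≤ zero    F a b c = refl
ΣP≡Σ≤ (suc n) F a b c = cong (_+ F (suc n) a b c) (ΣP≡Σ≤ n F a b c)

theorem3p6 : (n : ℕ) →
    Cpoly (suc n) ≈P ΣP n (λ k → (n C k) ⊙ (Cpoly k ⊗ Epoly (suc (n ∸ k))))
theorem3p6 n a b c = begin
  Cpoly (suc n) a b c
    ≡⟨ Cpoly≡∑ (suc n) a b c ⟩
  ∑ (δ³ a b c) (C-terms (suc n))
    ≡⟨ C-terms-Dⁿ n (δ³ a b c) ⟩
  Dⁿ n (δ³ a b c) (1 , 1 , 1) + 0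
    -- The iteration stopped at C_1 because C_1 = C_0 E_1: `C-terms 0` and `E-terms 0` evaluate to
    -- the single triples `(1 , 0 , 0)` and `(0 , 1 , 1)`, with product `(1 , 1 , 1)`. The double
    -- sum only adds a second 0.
    ≡⟨ sym (+-identityʳ _) ⟩
  ∑CE 0 0 (Dⁿ n (δ³ a b c))
    ≡⟨ ∑CE-Dⁿ n (δ³ a b c) ⟩
  Σ≤ n (λ k → (n C k) * ∑CE k (n ∸ k) (δ³ a b c))
    ≡⟨ Σ≤-cong n (λ k → cong ((n C k) *_) (sym (CE≡∑ k (n ∸ k) a b c))) ⟩
  Σ≤ n (λ k → (n C k) * (Cpoly k ⊗ Epoly (suc (n ∸ k))) a b c)
    ≡⟨ sym (ΣP≡Σ≤ n _ a b c) ⟩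
  ΣP n (λ k → (n C k) ⊙ (Cpoly k ⊗ Epoly (suc (n ∸ k)))) a b c ∎
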